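{- Let $n,d$ be integers such that $1\le d\le n$. The map $\mathcal{M}_{n,d}$ is a bijection from $\mathrm{SYT}(d,1^{n-d})$ to the set of Schröder paths $\widetilde{\mathrm{Sch}}_{n,d-1,(0)}$, with inverse $\mathcal{R}_{n,d}$. Moreover $\mathrm{maj}(\tau)=\mathrm{bounce}(\mathcal{M}_{n,d}(\tau))$ for all $\tau\in\mathrm{SYT}(d,1^{n-d})$ and $\mathrm{maj}(\mathcal{R}_{n,d}(\gamma))=\mathrm{bounce}(\gamma)$ for all $\gamma\in\widetilde{\mathrm{Sch}}_{n,d-1,(0)}$.
   Context: Words in $N=(0,1)$, $E=(1,0)$, $D=(1,1)$ are read as lattice paths starting at $(0,0)$. $\mathrm{Sch}_{n,d}$ is the set of Schröder paths with $d$ diagonal steps: words with $n-d$ $N$'s, $n-d$ $E$'s and $d$ $D$'s with $|\omega|_N\ge|\omega|_E$ for every prefix $\omega$. A Dyck path is a Schröder path without $D$. The area of a Schröder path is the number of lower triangles (lower halves of unit squares cut along the diagonal from bottom left to top right corner) under the path and above the main diagonal; equivalently the sum of $y-x$ over all $N$ and $D$ steps, $(x,y)$ being the starting point of the step. $\widetilde{\mathrm{Sch}}_{n,d,(0)}$ is the set of $\gamma\in\mathrm{Sch}_{n,d}$ ending with the factor $NE$ and having area $0$; equivalently the words $\gamma=\gamma_1\gamma_2\cdots\gamma_n$ with each $\gamma_i\in\{NE,D\}$, $\gamma_n=NE$, and exactly $d$ blocks equal to $D$. The sequence $(\gamma_1,\dots,\gamma_n)$ is called $\mathrm{Touch}(\gamma)$.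 Bounce: for a Dyck path of size $k$ ($k$ north steps), the bounce path starts at $(0,0)$, goes north until it reaches the starting point of an east step of the Dyck path, then east until it reaches the main diagonal, then north again, and so on until $(k,k)$; its bounce is the sum of $k-j$ over all points $(j,j)$, $1\le j\le k$, at which the bounce path returns to the main diagonal. For a Schröder path $\gamma$, let $\Gamma(\gamma)$ be the Dyck path obtained by deleting all $D$ steps. The points where the bounce path of $\Gamma(\gamma)$ turns from north to east are starting points of east steps of $\Gamma(\gamma)$; the corresponding east steps of $\gamma$ are the peak steps. $\mathrm{numph}(\gamma)$ is the sum over all $D$ steps of the number of peak steps preceding that $D$ step in the word, and $\mathrm{bounce}(\gamma)=\mathrm{bounce}(\Gamma(\gamma))+\mathrm{numph}(\gamma)$. $\mathrm{SYT}(\lambda)$: standard Young tableaux of shape $\lambda$ (French notation). $\mathrm{Des}(\tau)$ is the set of entries $i$ with $i+1$ in a strictly higher row; $\mathrm{maj}(\tau)$ is the sum of the elements of $\mathrm{Des}(\tau)$. A tableau in $\mathrm{SYT}(d,1^{n-d})$ is determined by its descent set, which can be any $(n-d)$-subset of $\{1,\dots,n-1\}$. $\mathcal{M}_{n,d}:\mathrm{SYT}(d,1^{n-d})\to\widetilde{\mathrm{Sch}}_{n,d-1,(0)}$ sends $\tau$ to $\gamma_1\cdots\gamma_n$ with $\gamma_n=NE$ and, for $1\le i\le n-1$, $\gamma_{n-i}=NE$ if $i\in\mathrm{Des}(\tau)$ and $\gamma_{n-i}=D$ otherwise. $\mathcal{R}_{n,d}:\widetilde{\mathrm{Sch}}_{n,d-1,(0)}\to\mathrm{SYT}(d,1^{n-d})$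 sends $\gamma$ to the tableau with descent set $\{n-i : 1\le i\le n-1,\ \gamma_i=NE\in\mathrm{Touch}(\gamma)\}$. -}

module Defs where

open import Data.Bool using (if_then_else_)
open import Data.Fin as Fin using (Fin; zero; suc; toℕ)
import Data.Fin.Properties as Fin
open import Data.List
  using (List; []; _∷_; [_]; _++_; map; length; concat; concatMap; filter; upTo; allFin; zip; replicate)
import Data.List as List
import Data.List.Properties as List
open import Data.List.Membership.Propositional using (_∈_; _∉_)
open import Data.List.Membership.Propositional.Properties
open import Data.List.Membership.Propositional.Properties.WithK using (unique∧set⇒bag)
open import Data.List.Relation.Binary.BagAndSetEquality using (_∼[_]_; set; ∼bag⇒↭)
open import Data.List.Relation.Binary.Permutation.Propositional using (_↭_; ↭-sym; ↭⇒↭ₛ)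
import Data.List.Relation.Binary.Permutation.Setoid.Properties as ↭ₛ
open import Data.List.Relation.Binary.Permutation.Propositional.Properties using (↭-length; ∈-resp-↭)
open import Data.List.Relation.Unary.All as All using (All; []; _∷_)
import Data.List.Relation.Unary.All.Properties as All
open import Data.List.Relation.Unary.AllPairs using (AllPairs; []; _∷_)
import Data.List.Relation.Unary.AllPairs.Properties as AllPairs
open import Data.List.Relation.Unary.Any using (here; there)
open import Data.List.Relation.Unary.Linked using (Linked; []; [-]; _∷_)
import Data.List.Relation.Unary.Linked.Properties as Linked
open import Data.List.Relation.Unary.Unique.Propositional using (Unique)
import Data.List.Relation.Unary.Unique.Propositional.Properties as Unique
open import Data.Nat
open import Data.Nat.ListAction using (sum)
open import Data.Nat.Properties
open import Data.Product using (∃₂; ∃-syntax; ∃!; _×_; _,_; proj₁; proj₂)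
import Data.Product.Properties as Product
open import Data.Sum using (inj₁; inj₂)
open import Data.Vec as Vec using (Vec; []; _∷_; tabulate; toList; fromList)
import Data.Vec.Properties as Vec
open import Function using (_∘_; id; _⇔_; mk⇔; Equivalence)
open import Relation.Binary.Definitions using (DecidableEquality)
open import Relation.Binary.PropositionalEquality
  using (_≡_; refl; sym; trans; cong; cong₂; subst; setoid; module ≡-Reasoning)
open import Relation.Nullary using (Dec; yes; no; does; ¬_; ¬?; contradiction; recompute)
open import Relation.Nullary.Decidable using (_×-dec_; dec-true; dec-false)

import Data.List.Membership.DecPropositional as DecMembership
open DecMembership _≟_ using (_∈?_)

data Step : Set where
  N E D : Step

_≟ˢ_ : DecidableEquality Step
N ≟ˢ N = yes refl
N ≟ˢ E = no λ ()
N ≟ˢ D = no λ ()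
E ≟ˢ N = no λ ()
E ≟ˢ E = yes refl
E ≟ˢ D = no λ ()
D ≟ˢ N = no λ ()
D ≟ˢ E = no λ ()
D ≟ˢ D = yes refl

Word : Set
Word = List Step

Point : Set
Point = ℕ × ℕ

_≟ᵖ_ : DecidableEquality Point
_≟ᵖ_ = Product.≡-dec _≟_ _≟_

open DecMembership _≟ᵖ_ using () renaming (_∈?_ to _∈ᵖ?_)

move : Step → Point → Point
move N (x , y) = x , suc y
move E (x , y) = suc x , y
move D (x , y) = suc x , suc y

∣_∣[_] : Word → Step → ℕ
∣ w ∣[ s ] = length (filter (_≟ˢ s) w)

record IsSchröder (n d : ℕ) (w : Word) : Set where
  field
    #N≡n∸d : ∣ w ∣[ N ] ≡ n ∸ d
    #E≡n∸d : ∣ w ∣[ E ] ≡ n ∸ d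
    #D≡d   : ∣ w ∣[ D ] ≡ d
    ballot : ∀ u v → w ≡ u ++ v → ∣ u ∣[ E ] ≤ ∣ u ∣[ N ]

-- Truncated subtraction is harmless: y ≥ x all along a Schröder path.
areaFrom : Point → Word → ℕ
areaFrom p       []      = 0
areaFrom (x , y) (N ∷ w) = (y ∸ x) + areaFrom (move N (x , y)) w
areaFrom p       (E ∷ w) = areaFrom (move E p) w
areaFrom (x , y) (D ∷ w) = (y ∸ x) + areaFrom (move D (x , y)) w

area : Word → ℕ
area = areaFrom (0 , 0)

record IsSch₀ (n d : ℕ) (w : Word) : Set where
  field
    isSchröder : IsSchröder n d w
    endsNE     : ∃[ u ] w ≡ u ++ N ∷ E ∷ []
    area≡0     : area w ≡ 0

-- The membership proof is irrelevant, so that equality is equality of words.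
record Sch₀ (n d : ℕ) : Set where
  constructor mkSch₀
  field
    word    : Word
    .isSch₀ : IsSch₀ n d word

Γ : Word → Word
Γ = filter (λ s → ¬? (s ≟ˢ D))

eastStarts : Point → Word → List Point
eastStarts p []      = []
eastStarts p (E ∷ w) = p ∷ eastStarts (move E p) w
eastStarts p (s ∷ w) = eastStarts (move s p) w

-- The next m steps of the bounce path from p, when heading north or east,
-- where es lists the starting points of the east steps of the Dyck path.
north east : (es : List Point) (m : ℕ) → Point → Word
north es zero    p = []
north es (suc m) p =
  if does (p ∈ᵖ? es) then E ∷ east es m (move E p) else N ∷ north es m (move N p)
east es zero    p = []
east es (suc m) p =
  if does (proj₁ p ≟ proj₂ p) then N ∷ north es m (move N p) else E ∷ east es m (move E p)

-- The bounce path has as many steps as the Dyck path itself.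
bouncePath : Word → Word
bouncePath w = north (eastStarts (0 , 0) w) (length w) (0 , 0)

-- The j such that (j , j) is visited after the start of the path.
returnsFrom : Point → Word → List ℕ
returnsFrom p []      = []
returnsFrom p (s ∷ w) =
  let q = move s p in
  if does (proj₁ q ≟ proj₂ q) then proj₁ q ∷ returnsFrom q w else returnsFrom q w

bounceDyck : Word → ℕ
bounceDyck w = sum (map (∣ w ∣[ N ] ∸_) (returnsFrom (0 , 0) (bouncePath w)))

-- The points at which a path turns from north to east.
turnsFrom : Point → Word → List Point
turnsFrom p []          = []
turnsFrom p (N ∷ E ∷ w) = move N p ∷ turnsFrom (move N p) (E ∷ w)
turnsFrom p (s ∷ w)     = turnsFrom (move s p) w

-- ts lists the starting points in Γ(γ) of the peak steps, c counts the peak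
-- steps already met, and p is the current point of Γ(γ), which is why diagonal
-- steps do not move it.
numphFrom : (ts : List Point) (p : Point) (c : ℕ) → Word → ℕ
numphFrom ts p c []      = 0
numphFrom ts p c (N ∷ w) = numphFrom ts (move N p) c w
numphFrom ts p c (E ∷ w) = numphFrom ts (move E p) (if does (p ∈ᵖ? ts) then suc c else c) w
numphFrom ts p c (D ∷ w) = c + numphFrom ts p c w

numph : Word → ℕ
numph w = numphFrom (turnsFrom (0 , 0) (bouncePath (Γ w))) (0 , 0) 0 w

bounce : ∀ {n d} → Sch₀ n d → ℕ
bounce γ = bounceDyck (Γ w) + numph w
  where w = Sch₀.word γ

[1⋯_] : ℕ → List ℕ
[1⋯ n ] = map suc (upTo n)

Above : List ℕ → List ℕ → Set
Above lower upper = All (λ (a , b) → a < b) (zip lower upper)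

-- French notation: a filling is the list of its rows from bottom to top.
record IsSYT (sh : List ℕ) (rows : List (List ℕ)) : Set where
  field
    shape   : map length rows ≡ sh
    rows↗   : All (Linked _<_) rows
    cols↗   : Linked Above rows
    entries : concat rows ↭ [1⋯ sum sh ]

record SYT (sh : List ℕ) : Set where
  constructor mkSYT
  field
    rows   : List (List ℕ)
    .isSYT : IsSYT sh rows

Descent : List (List ℕ) → ℕ → Set
Descent rows i = ∃₂ λ (r s : Fin (length rows)) →
  r Fin.< s × i ∈ List.lookup rows r × suc i ∈ List.lookup rows s

descent? : ∀ rows i → Dec (Descent rows i)
descent? rows i = Fin.any? λ r → Fin.any? λ s →
  r Fin.<? s ×-dec i ∈? List.lookup rows r ×-dec suc i ∈? List.lookup rows s

Des : ∀ {sh} → SYT sh → List ℕ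
Des {sh} τ = filter (descent? (SYT.rows τ)) [1⋯ sum sh ]

maj : ∀ {sh} → SYT sh → ℕ
maj τ = sum (Des τ)

hook : ℕ → ℕ → List ℕ
hook n d = d ∷ replicate (n ∸ d) 1

data Block : Set where
  NE D : Block

_≟ᵇ_ : DecidableEquality Block
NE ≟ᵇ NE = yes refl
NE ≟ᵇ D  = no λ ()
D  ≟ᵇ NE = no λ ()
D  ≟ᵇ D  = yes refl

blockWord : Block → Word
blockWord NE = N ∷ E ∷ []
blockWord D  = D ∷ []

unblock : ∀ {n} → Vec Block n → Word
unblock = concatMap blockWord ∘ toList

-- Only meaningful on the words of Sch₀, where touch-correct below applies.
touch : Word → List Block
touch (N ∷ E ∷ w) = NE ∷ touch w
touch (D ∷ w)     = D ∷ touch w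
touch _           = []

-- γ₁ ⋯ γₙ is indexed by Fin n: γⱼ₊₁ is the component at toℕ j, so that γₙ₋ᵢ is
-- the component at j with i = n ∸ suc (toℕ j).
majBlocks : ∀ n → List ℕ → Vec Block n
majBlocks n S = tabulate λ j →
  if does (suc (toℕ j) ≟ n) then NE else
  if does (n ∸ suc (toℕ j) ∈? S) then NE else D

blockDescents : ∀ {n} → Vec Block n → List ℕ
blockDescents {n} bs =
  map (λ j → n ∸ suc (toℕ j))
      (filter (λ j → suc (toℕ j) <? n ×-dec Vec.lookup bs j ≟ᵇ NE) (allFin n))

sorted-≡ : ∀ {xs ys} → AllPairs _<_ xs → AllPairs _<_ ys →
           (∀ {z} → z ∈ xs → z ∈ ys) → (∀ {z} → z ∈ ys → z ∈ xs) → xs ≡ ys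
sorted-≡ [] [] f g = refl
sorted-≡ [] (_ ∷ _) f g = contradiction (g (here refl)) λ ()
sorted-≡ (_ ∷ _) [] f g = contradiction (f (here refl)) λ ()
sorted-≡ {x ∷ xs} {y ∷ ys} (x<xs ∷ xs↗) (y<ys ∷ ys↗) f g =
  cong₂ _∷_ x≡y (sorted-≡ xs↗ ys↗ f′ g′)
  where
  x≡y : x ≡ y
  x≡y with f (here refl) | g (here refl)
  ... | here x≡y   | _          = x≡y
  ... | there _    | here y≡x   = sym y≡x
  ... | there x∈ys | there y∈xs =
    contradiction (All.lookup x<xs y∈xs) (<-asym (All.lookup y<ys x∈ys))
  f′ : ∀ {z} → z ∈ xs → z ∈ ys
  f′ z∈xs with f (there z∈xs)
  ... | there z∈ys = z∈ys
  ... | here z≡y   = contradiction (trans x≡y (sym z≡y)) (<⇒≢ (All.lookup x<xs z∈xs))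
  g′ : ∀ {z} → z ∈ ys → z ∈ xs
  g′ z∈ys with g (there z∈ys)
  ... | there z∈xs = z∈xs
  ... | here z≡x   = contradiction (sym (trans z≡x x≡y)) (<⇒≢ (All.lookup y<ys z∈ys))

sorted⇒unique : ∀ {xs} → AllPairs _<_ xs → Unique xs
sorted⇒unique []           = []
sorted⇒unique (x<xs ∷ xs↗) = All.map <⇒≢ x<xs ∷ sorted⇒unique xs↗

unique-++-disjoint : ∀ (xs : List ℕ) {ys z} → Unique (xs ++ ys) → z ∈ xs → z ∉ ys
unique-++-disjoint (x ∷ xs) (x∉ ∷ _) (here refl) z∈ys = All.lookup x∉ (∈-++⁺ʳ xs z∈ys) refl
unique-++-disjoint (x ∷ xs) (_ ∷ u)  (there z∈xs) z∈ys = unique-++-disjoint xs u z∈xs z∈ys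

[1⋯]↗ : ∀ n → AllPairs _<_ [1⋯ n ]
[1⋯]↗ n = AllPairs.map⁺ (AllPairs.applyUpTo⁺₁ id n λ i<j _ → s<s i<j)

∈[1⋯]⁺ : ∀ {n i} → 1 ≤ i → i ≤ n → i ∈ [1⋯ n ]
∈[1⋯]⁺ {i = suc i} _ i<n = ∈-map⁺ suc (∈-upTo⁺ i<n)

∈[1⋯]⁻ : ∀ {n i} → i ∈ [1⋯ n ] → 1 ≤ i × i ≤ n
∈[1⋯]⁻ i∈ with ∈-map⁻ suc i∈
... | _ , j∈ , refl = s≤s z≤n , ∈-upTo⁻ j∈

set⇒length : ∀ {xs ys : List ℕ} → Unique xs → Unique ys →
             xs ∼[ set ] ys → length xs ≡ length ys
set⇒length p q eq = ↭-length (∼bag⇒↭ (unique∧set⇒bag p q eq))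

fill : List ℕ → List ℕ → List (List ℕ)
fill xs cs = (1 ∷ xs) ∷ map [_] cs

record HookParts (a k m : ℕ) (xs cs : List ℕ) : Set where
  field
    xs↗  : AllPairs _<_ (1 ∷ xs)
    cs↗  : AllPairs _<_ (1 ∷ cs)
    |xs| : length xs ≡ a
    |cs| : length cs ≡ k
    perm : 1 ∷ xs ++ cs ↭ [1⋯ m ]

  all-unique : Unique (1 ∷ xs ++ cs)
  all-unique = ↭ₛ.Unique-resp-↭ (setoid ℕ) (↭⇒↭ₛ (↭-sym perm)) (sorted⇒unique ([1⋯]↗ m))

fill-isSYT : ∀ {a k xs cs} → HookParts a k (sum (suc a ∷ replicate k 1)) xs cs →
             IsSYT (suc a ∷ replicate k 1) (fill xs cs)
fill-isSYT {a} {k} {xs} {cs} parts = record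
  { shape   = cong₂ _∷_ (cong suc |xs|) (trans (lengths cs) (cong (λ l → replicate l 1) |cs|))
  ; rows↗   = Linked.AllPairs⇒Linked xs↗ ∷ All.map⁺ (All.universal (λ _ → [-]) cs)
  ; cols↗   = cols xs cs↗
  ; entries = subst (λ l → 1 ∷ xs ++ l ↭ [1⋯ sum (suc a ∷ replicate k 1) ])
                    (sym (List.concat-map-[ cs ])) perm
  }
  where
  open HookParts parts
  lengths : ∀ cs → map length (map [_] cs) ≡ replicate (length cs) 1
  lengths []       = refl
  lengths (_ ∷ cs) = cong (1 ∷_) (lengths cs)
  cols : ∀ {x cs} xs → AllPairs _<_ (x ∷ cs) → Linked Above ((x ∷ xs) ∷ map [_] cs)
  cols {cs = []}    xs       _                 = [-]
  cols {cs = _ ∷ _} []       ((x<c ∷ _) ∷ cs↗) = (x<c ∷ []) ∷ cols [] cs↗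
  cols {cs = _ ∷ _} (_ ∷ _)  ((x<c ∷ _) ∷ cs↗) = (x<c ∷ []) ∷ cols [] cs↗

hookParts : ∀ a k rows → IsSYT (suc a ∷ replicate k 1) rows →
            ∃₂ λ xs cs → rows ≡ fill xs cs × HookParts a k (sum (suc a ∷ replicate k 1)) xs cs
hookParts a k rows isSYT = go rows shape rows↗ cols↗ entries
  where
  open IsSYT isSYT
  m = sum (suc a ∷ replicate k 1)
  singles : ∀ k (rs : List (List ℕ)) → map length rs ≡ replicate k 1 → ∃[ cs ] rs ≡ map [_] cs × length cs ≡ k
  singles zero    []              _  = [] , refl , refl
  singles (suc k) ([]          ∷ _)  eq = contradiction (List.∷-injectiveˡ eq) λ ()
  singles (suc k) ((_ ∷ _ ∷ _) ∷ _)  eq = contradiction (List.∷-injectiveˡ eq) λ ()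
  singles (suc k) ((c ∷ [])    ∷ rs) eq with singles k rs (List.∷-injectiveʳ eq)
  ... | cs , refl , refl = c ∷ cs , refl , refl
  col : ∀ {x} xs cs → Linked Above ((x ∷ xs) ∷ map [_] cs) → Linked _<_ (x ∷ cs)
  col xs []       _                = [-]
  col xs (c ∷ cs) ((x<c ∷ _) ∷ ab) = x<c ∷ col [] cs ab
  go : ∀ rows → map length rows ≡ suc a ∷ replicate k 1 → All (Linked _<_) rows →
       Linked Above rows → concat rows ↭ [1⋯ m ] →
       ∃₂ λ xs cs → rows ≡ fill xs cs × HookParts a k m xs cs
  go ([] ∷ _) eq _ _ _ = contradiction (List.∷-injectiveˡ eq) λ ()
  go ((x ∷ xs) ∷ rs) eq (x∷xs↗ ∷ _) ab p with singles k rs (List.∷-injectiveʳ eq)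
  ... | cs , refl , |cs| rewrite List.concat-map-[ cs ] = result x≡1 p x∷xs↗ (col xs cs ab)
    where
    xs↗ = Linked.Linked⇒AllPairs <-trans x∷xs↗
    cs↗ = Linked.Linked⇒AllPairs <-trans (col xs cs ab)
    1≤x : 1 ≤ x
    1≤x = proj₁ (∈[1⋯]⁻ (∈-resp-↭ p (here refl)))
    bound : ∀ {zs} → AllPairs _<_ (x ∷ zs) → 1 ∉ zs
    bound (x<zs ∷ _) 1∈ = <⇒≱ (All.lookup x<zs 1∈) 1≤x
    x≡1 : x ≡ 1
    x≡1 with ∈-resp-↭ (↭-sym p) (∈[1⋯]⁺ (s≤s z≤n) (s≤s z≤n))
    ... | here 1≡x = sym 1≡x
    ... | there 1∈ with ∈-++⁻ xs 1∈
    ...   | inj₁ 1∈xs = contradiction 1∈xs (bound xs↗)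
    ...   | inj₂ 1∈cs = contradiction 1∈cs (bound cs↗)
    result : ∀ {x} → x ≡ 1 → x ∷ xs ++ cs ↭ [1⋯ m ] → Linked _<_ (x ∷ xs) → Linked _<_ (x ∷ cs) →
             ∃₂ λ xs′ cs′ → (x ∷ xs) ∷ map [_] cs ≡ fill xs′ cs′ × HookParts a k m xs′ cs′
    result refl p l₁ l₂ = xs , cs , refl , record
      { xs↗  = Linked.Linked⇒AllPairs <-trans l₁
      ; cs↗  = Linked.Linked⇒AllPairs <-trans l₂
      ; |xs| = suc-injective (List.∷-injectiveˡ eq)
      ; |cs| = |cs|
      ; perm = p
      }

∈-singles⁻ : ∀ (cs : List ℕ) r {j} → j ∈ List.lookup (map [_] cs) r → j ∈ cs
∈-singles⁻ (c ∷ cs) zero    (here refl) = here refl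
∈-singles⁻ (c ∷ cs) (suc r) j∈          = there (∈-singles⁻ cs r j∈)

∈-singles⁺ : ∀ {cs : List ℕ} {j} → j ∈ cs → ∃[ r ] j ∈ List.lookup (map [_] cs) r
∈-singles⁺ (here refl) = zero , here refl
∈-singles⁺ (there j∈)  = let r , j∈r = ∈-singles⁺ j∈ in suc r , j∈r

singles-< : ∀ {cs i j} → AllPairs _<_ cs → i < j → i ∈ cs → j ∈ cs →
            ∃₂ λ r s → r Fin.< s × i ∈ List.lookup (map [_] cs) r × j ∈ List.lookup (map [_] cs) s
singles-< _ i<j (here refl) (here refl) = contradiction i<j (n≮n _)
singles-< _ i<j (here refl) (there j∈) =
  let s , j∈s = ∈-singles⁺ j∈ in zero , suc s , s≤s z≤n , here refl , j∈s
singles-< (c<cs ∷ _) i<j (there i∈) (here refl) =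
  contradiction (All.lookup c<cs i∈) (<-asym i<j)
singles-< (_ ∷ cs↗) i<j (there i∈) (there j∈) =
  let r , s , r<s , i∈r , j∈s = singles-< cs↗ i<j i∈ j∈
  in suc r , suc s , s<s r<s , i∈r , j∈s

module _ {a k m xs cs} (parts : HookParts a k m xs cs) where
  open HookParts parts

  ∈-Des⁻ : ∀ {i} → i ∈ filter (descent? (fill xs cs)) [1⋯ m ] → suc i ∈ cs
  ∈-Des⁻ i∈ with ∈-filter⁻ (descent? (fill xs cs)) {xs = [1⋯ m ]} i∈
  ... | _ , _ , suc s , _ , _ , i+1∈s = ∈-singles⁻ cs s i+1∈s

  ∈-Des⁺ : ∀ {i} → suc i ∈ cs → i ∈ filter (descent? (fill xs cs)) [1⋯ m ]
  ∈-Des⁺ {i} i+1∈cs = ∈-filter⁺ (descent? (fill xs cs)) i∈[1⋯m] (descent i∈all)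
    where
    1≤i : 1 ≤ i
    1≤i with 1<cs ∷ _ ← cs↗ = s≤s⁻¹ (All.lookup 1<cs i+1∈cs)
    i∈[1⋯m] : i ∈ [1⋯ m ]
    i∈[1⋯m] = ∈[1⋯]⁺ 1≤i (<⇒≤ (proj₂ (∈[1⋯]⁻ (∈-resp-↭ perm (there (∈-++⁺ʳ xs i+1∈cs))))))
    i∈all : i ∈ (1 ∷ xs) ++ cs
    i∈all = ∈-resp-↭ (↭-sym perm) i∈[1⋯m]
    descent : i ∈ (1 ∷ xs) ++ cs → Descent (fill xs cs) i
    descent i∈ with ∈-++⁻ (1 ∷ xs) i∈
    ... | inj₁ i∈row = let s , i+1∈s = ∈-singles⁺ i+1∈cs in zero , suc s , s≤s z≤n , i∈row , i+1∈s
    ... | inj₂ i∈cs with _ ∷ cs↗′ ← cs↗ =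
      let r , s , r<s , i∈r , i+1∈s = singles-< cs↗′ (n<1+n i) i∈cs i+1∈cs
      in suc r , suc s , s<s r<s , i∈r , i+1∈s

  |Des| : length (filter (descent? (fill xs cs)) [1⋯ m ]) ≡ k
  |Des| = begin
    length des           ≡⟨ List.length-map suc des ⟨
    length (map suc des) ≡⟨ set⇒length (Unique.map⁺ suc-injective
                              (Unique.filter⁺ (descent? (fill xs cs)) (sorted⇒unique ([1⋯]↗ m))))
                              cs-unique (λ {z} → mk⇔ to from) ⟩
    length cs            ≡⟨ |cs| ⟩
    k                    ∎
    where
    open ≡-Reasoning
    des = filter (descent? (fill xs cs)) [1⋯ m ]
    cs-unique : Unique cs
    cs-unique with _ ∷ u ← sorted⇒unique cs↗ = u
    to : ∀ {z} → z ∈ map suc des → z ∈ cs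
    to z∈ with ∈-map⁻ suc z∈
    ... | _ , i∈ , refl = ∈-Des⁻ i∈
    from : ∀ {z} → z ∈ cs → z ∈ map suc des
    from {zero} z∈ with 1<cs ∷ _ ← cs↗ = contradiction (All.lookup 1<cs z∈) λ ()
    from {suc _} z∈ = ∈-map⁺ suc (∈-Des⁺ z∈)

fill-≡ : ∀ {a k m xs cs xs′ cs′} → HookParts a k m xs cs → HookParts a k m xs′ cs′ →
         (∀ {z} → z ∈ cs → z ∈ cs′) → (∀ {z} → z ∈ cs′ → z ∈ cs) → fill xs cs ≡ fill xs′ cs′
fill-≡ {a} {k} {m} {xs} {cs} {xs′} {cs′} p p′ f g with P.xs↗ | P.cs↗ | P′.xs↗ | P′.cs↗
  where module P = HookParts p; module P′ = HookParts p′
... | 1<xs ∷ xs↗ | _ ∷ cs↗ | 1<xs′ ∷ xs′↗ | _ ∷ cs′↗ =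
  cong₂ fill (sorted-≡ xs↗ xs′↗ (arm p p′ g) (arm p′ p f)) (sorted-≡ cs↗ cs′↗ f g)
  where
  arm : ∀ {xs cs xs′ cs′} → HookParts a k m xs cs → HookParts a k m xs′ cs′ →
        (∀ {z} → z ∈ cs′ → z ∈ cs) → ∀ {z} → z ∈ xs → z ∈ xs′
  arm {xs} {cs} {xs′} p p′ g {z} z∈xs
    with HookParts.all-unique p
       | ∈-resp-↭ (↭-sym (HookParts.perm p′)) (∈-resp-↭ (HookParts.perm p) (there (∈-++⁺ˡ z∈xs)))
  ... | 1∉ ∷ _ | here refl = contradiction refl (All.lookup 1∉ (∈-++⁺ˡ z∈xs))
  ... | _ ∷ u  | there z∈ with ∈-++⁻ xs′ z∈
  ...   | inj₁ z∈xs′ = z∈xs′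
  ...   | inj₂ z∈cs′ = contradiction (g z∈cs′) (unique-++-disjoint xs u z∈xs)

hookParts-of : ∀ a k S → Unique S → All (λ i → 1 ≤ i × i ≤ a + k) S → length S ≡ k →
               ∃₂ λ xs cs → HookParts a k (suc (a + k)) xs cs ×
                            (∀ i → i ∈ S ⇔ suc i ∈ cs)
hookParts-of a k S S! bounds |S| = xs , cs , parts , λ i → mk⇔ (to i) (from i)
  where
  p = a + k
  in? = _∈? S
  out? = λ i → ¬? (i ∈? S)
  ins = filter in? [1⋯ p ]
  outs = filter out? [1⋯ p ]
  xs = map suc outs
  cs = map suc ins

  ins-set : ins ∼[ set ] S
  ins-set = mk⇔ (λ i∈ → proj₂ (∈-filter⁻ in? {xs = [1⋯ p ]} i∈))
                (λ i∈ → let 1≤i , i≤p = All.lookup bounds i∈ in ∈-filter⁺ in? (∈[1⋯]⁺ 1≤i i≤p) i∈)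

  to : ∀ i → i ∈ S → suc i ∈ cs
  to i i∈ = ∈-map⁺ suc (Equivalence.from ins-set i∈)
  from : ∀ i → suc i ∈ cs → i ∈ S
  from i i∈ with ∈-map⁻ suc i∈
  ... | _ , j∈ , refl = Equivalence.to ins-set j∈

  ↗ : ∀ {P : ℕ → Set} (P? : ∀ i → Dec (P i)) → AllPairs _<_ (1 ∷ map suc (filter P? [1⋯ p ]))
  ↗ P? = All.map⁺ (All.tabulate λ i∈ → s<s (proj₁ (∈[1⋯]⁻ (proj₁ (∈-filter⁻ P? {xs = [1⋯ p ]} i∈)))))
       ∷ AllPairs.map⁺ (AllPairs.filter⁺ P? (AllPairs-map s<s ([1⋯]↗ p)))
    where
    AllPairs-map : ∀ {xs} → (∀ {i j} → i < j → suc i < suc j) →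
                   AllPairs _<_ xs → AllPairs (λ i j → suc i < suc j) xs
    AllPairs-map f []       = []
    AllPairs-map f (q ∷ qs) = All.map f q ∷ AllPairs-map f qs

  disjoint : ∀ {z} → ¬ (z ∈ xs × z ∈ cs)
  disjoint (z∈xs , z∈cs) with ∈-map⁻ suc z∈xs
  ... | i , i∈ , refl = proj₂ (∈-filter⁻ out? {xs = [1⋯ p ]} i∈) (from i z∈cs)

  unique : Unique (1 ∷ xs ++ cs)
  unique with ↗ out? | ↗ in?
  ... | 1<xs ∷ xs↗ | 1<cs ∷ cs↗ =
    All.map <⇒≢ (All.++⁺ 1<xs 1<cs) ∷ Unique.++⁺ (sorted⇒unique xs↗) (sorted⇒unique cs↗) disjoint

  to′ : ∀ {z} → z ∈ 1 ∷ xs ++ cs → z ∈ [1⋯ suc p ]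
  to′ (here refl) = here refl
  to′ (there z∈) with ∈-++⁻ xs z∈
  ... | inj₁ z∈xs with i , i∈ , refl ← ∈-map⁻ suc z∈xs =
    ∈[1⋯]⁺ (s≤s z≤n) (s≤s (proj₂ (∈[1⋯]⁻ (proj₁ (∈-filter⁻ out? {xs = [1⋯ p ]} i∈)))))
  ... | inj₂ z∈cs with i , i∈ , refl ← ∈-map⁻ suc z∈cs =
    ∈[1⋯]⁺ (s≤s z≤n) (s≤s (proj₂ (∈[1⋯]⁻ (proj₁ (∈-filter⁻ in? {xs = [1⋯ p ]} i∈)))))

  from′ : ∀ {z} → z ∈ [1⋯ suc p ] → z ∈ 1 ∷ xs ++ cs
  from′ {zero} z∈ = contradiction (proj₁ (∈[1⋯]⁻ z∈)) λ ()
  from′ {suc zero} z∈ = here refl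
  from′ {suc (suc i)} z∈ with suc i ∈? S
  ... | yes i∈ = there (∈-++⁺ʳ xs (to (suc i) i∈))
  ... | no  i∉ = there (∈-++⁺ˡ (∈-map⁺ suc (∈-filter⁺ out?
                   (∈[1⋯]⁺ (s≤s z≤n) (s≤s⁻¹ (proj₂ (∈[1⋯]⁻ z∈)))) i∉)))

  perm : 1 ∷ xs ++ cs ↭ [1⋯ suc p ]
  perm = ∼bag⇒↭ (unique∧set⇒bag unique (sorted⇒unique ([1⋯]↗ (suc p))) (mk⇔ to′ from′))

  |cs| : length cs ≡ k
  |cs| = trans (List.length-map suc ins) (trans
    (set⇒length (Unique.filter⁺ in? (sorted⇒unique ([1⋯]↗ p))) S! ins-set) |S|)

  |xs| : length xs ≡ a
  |xs| = +-cancelʳ-≡ k (length xs) a (begin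
    length xs + k         ≡⟨ cong (length xs +_) |cs| ⟨
    length xs + length cs ≡⟨ List.length-++ xs ⟨
    length (xs ++ cs)     ≡⟨ suc-injective (↭-length perm) ⟩
    length (map suc (List.applyUpTo suc p)) ≡⟨ List.length-map suc (List.applyUpTo suc p) ⟩
    length (List.applyUpTo suc p) ≡⟨ List.length-applyUpTo suc p ⟩
    a + k                 ∎)
    where open ≡-Reasoning

  parts : HookParts a k (suc p) xs cs
  parts = record { xs↗ = ↗ out? ; cs↗ = ↗ in? ; |xs| = |xs| ; |cs| = |cs| ; perm = perm }

sum-ones : ∀ k → sum (replicate k 1) ≡ k
sum-ones zero    = refl
sum-ones (suc k) = cong suc (sum-ones k)

-- Tableaux of shape (d , 1ⁿ⁻ᵈ) correspond to (n - d)-subsets of {1 , … , n - 1}.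
hook-∃! : ∀ n d → .(1 ≤ d) → .(d ≤ n) → (S : List ℕ) →
          Unique S → All (λ i → 1 ≤ i × i < n) S → .(length S ≡ n ∸ d) →
          ∃! _≡_ λ (τ : SYT (hook n d)) → Des τ ∼[ set ] S
hook-∃! n zero    () _ S S! bounds |S|
hook-∃! n (suc a) _ d≤n S S! bounds |S| = τ , (λ {i} → mk⇔ (to i) (from i)) , unique _
  where
  k = n ∸ suc a
  m = sum (hook n (suc a))
  n≡1+a+k : n ≡ suc (a + k)
  n≡1+a+k = sym (m+[n∸m]≡n (recompute (suc a ≤? n) d≤n))
  m≡1+a+k : m ≡ suc (a + k)
  m≡1+a+k = cong (suc a +_) (sum-ones k)
  found : ∃₂ λ xs cs → HookParts a k (suc (a + k)) xs cs × (∀ i → i ∈ S ⇔ suc i ∈ cs)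
  found = hookParts-of a k S S!
    (All.map (λ { (1≤i , i<n) → 1≤i , s≤s⁻¹ (subst (_ <_) n≡1+a+k i<n) }) bounds)
    (recompute (length S ≟ k) |S|)
  xs = proj₁ found
  cs = proj₁ (proj₂ found)
  parts : HookParts a k m xs cs
  parts = subst (λ m → HookParts a k m xs cs) (sym m≡1+a+k) (proj₁ (proj₂ (proj₂ found)))
  S⇔cs : ∀ i → i ∈ S ⇔ suc i ∈ cs
  S⇔cs = proj₂ (proj₂ (proj₂ found))
  τ : SYT (hook n (suc a))
  τ = mkSYT (fill xs cs) (fill-isSYT parts)
  to : ∀ i → i ∈ Des τ → i ∈ S
  to i i∈ = Equivalence.from (S⇔cs i) (∈-Des⁻ parts i∈)
  from : ∀ i → i ∈ S → i ∈ Des τ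
  from i i∈ = ∈-Des⁺ parts (Equivalence.to (S⇔cs i) i∈)

  rows-≡ : ∀ rows (p : IsSYT (hook n (suc a)) rows) →
           Des (mkSYT rows p) ∼[ set ] S → fill xs cs ≡ rows
  rows-≡ rows p eq with hookParts a k rows p
  ... | xs′ , cs′ , refl , parts′ = fill-≡ parts parts′ f g
    where
    f : ∀ {z} → z ∈ cs → z ∈ cs′
    f {zero} z∈ with 1<cs ∷ _ ← HookParts.cs↗ parts = contradiction (All.lookup 1<cs z∈) λ ()
    f {suc i} z∈ = ∈-Des⁻ parts′ (Equivalence.from eq (Equivalence.from (S⇔cs i) z∈))
    g : ∀ {z} → z ∈ cs′ → z ∈ cs
    g {zero} z∈ with 1<cs ∷ _ ← HookParts.cs↗ parts′ = contradiction (All.lookup 1<cs z∈) λ ()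
    g {suc i} z∈ = Equivalence.to (S⇔cs i) (Equivalence.to eq (∈-Des⁺ parts′ z∈))

  SYT-≡ : ∀ {sh} {σ σ′ : SYT sh} → SYT.rows σ ≡ SYT.rows σ′ → σ ≡ σ′
  SYT-≡ refl = refl

  unique : ∀ σ → Des σ ∼[ set ] S → τ ≡ σ
  unique (mkSYT rows p) eq =
    SYT-≡ (recompute (List.≡-dec (List.≡-dec _≟_) (fill xs cs) rows) (rows-≡ rows p eq))

|Des|-hook : ∀ n d → 1 ≤ d → ∀ rows (p : IsSYT (hook n d) rows) → length (Des (mkSYT rows p)) ≡ n ∸ d
|Des|-hook n (suc a) _ rows p with hookParts a (n ∸ suc a) rows p
... | _ , _ , refl , parts = |Des| parts

#NE : List Block → ℕ
#NE bs = length (filter (_≟ᵇ NE) bs)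

#D : List Block → ℕ
#D bs = length (filter (_≟ᵇ D) bs)

#NE+#D : ∀ bs → #NE bs + #D bs ≡ length bs
#NE+#D []        = refl
#NE+#D (NE ∷ bs) = cong suc (#NE+#D bs)
#NE+#D (D ∷ bs)  = trans (+-suc (#NE bs) (#D bs)) (cong suc (#NE+#D bs))

blocks-N : ∀ bs → ∣ concatMap blockWord bs ∣[ N ] ≡ #NE bs
blocks-N []        = refl
blocks-N (NE ∷ bs) = cong suc (blocks-N bs)
blocks-N (D ∷ bs)  = blocks-N bs

blocks-E : ∀ bs → ∣ concatMap blockWord bs ∣[ E ] ≡ #NE bs
blocks-E []        = refl
blocks-E (NE ∷ bs) = cong suc (blocks-E bs)
blocks-E (D ∷ bs)  = blocks-E bs

blocks-D : ∀ bs → ∣ concatMap blockWord bs ∣[ D ] ≡ #D bs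
blocks-D []        = refl
blocks-D (NE ∷ bs) = blocks-D bs
blocks-D (D ∷ bs)  = cong suc (blocks-D bs)

blocks-ballot : ∀ bs u v → concatMap blockWord bs ≡ u ++ v → ∣ u ∣[ E ] ≤ ∣ u ∣[ N ]
blocks-ballot bs        []          v eq   = z≤n
blocks-ballot (NE ∷ bs) (N ∷ [])    v eq   = z≤n
blocks-ballot (NE ∷ bs) (N ∷ E ∷ u) v eq   =
  s≤s (blocks-ballot bs u v (List.∷-injectiveʳ (List.∷-injectiveʳ eq)))
blocks-ballot (D ∷ bs)  (D ∷ u)     v eq   = blocks-ballot bs u v (List.∷-injectiveʳ eq)

blocks-area : ∀ x bs → areaFrom (x , x) (concatMap blockWord bs) ≡ 0
blocks-area x []        = refl
blocks-area x (NE ∷ bs) = trans (cong (_+ areaFrom (suc x , suc x) (concatMap blockWord bs)) (n∸n≡0 x))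
                                (blocks-area (suc x) bs)
blocks-area x (D ∷ bs)  = trans (cong (_+ areaFrom (suc x , suc x) (concatMap blockWord bs)) (n∸n≡0 x))
                                (blocks-area (suc x) bs)

LastNE : ∀ {n} → Vec Block n → Set
LastNE {n} bs = ∀ j → suc (toℕ j) ≡ n → Vec.lookup bs j ≡ NE

lastNE-tail : ∀ {n b} {bs : Vec Block n} → LastNE (b ∷ bs) → LastNE bs
lastNE-tail last j eq = last (suc j) (cong suc eq)

lastNE-endsNE : ∀ {n} (bs : Vec Block n) → 0 < n → LastNE bs →
                ∃[ u ] unblock bs ≡ u ++ N ∷ E ∷ []
lastNE-endsNE (b ∷ [])      _ last with refl ← last zero refl = [] , refl
lastNE-endsNE (b ∷ b′ ∷ bs) _ last =
  let u , eq = lastNE-endsNE (b′ ∷ bs) (s≤s z≤n) (lastNE-tail {bs = b′ ∷ bs} last)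
  in blockWord b ++ u , trans (cong (blockWord b ++_) eq) (sym (List.++-assoc (blockWord b) u _))

endsNE-lastNE : ∀ {n} (bs : Vec Block n) u → unblock bs ≡ u ++ N ∷ E ∷ [] → LastNE bs
endsNE-lastNE (NE ∷ [])     u           eq   zero    _ = refl
endsNE-lastNE (D ∷ [])      (_ ∷ [])    eq   zero    _ = contradiction (List.∷-injectiveʳ eq) λ ()
endsNE-lastNE (D ∷ [])      (_ ∷ _ ∷ _) eq   zero    _ = contradiction (List.∷-injectiveʳ eq) λ ()
endsNE-lastNE (b ∷ b′ ∷ bs) u           eq   zero    p = contradiction (suc-injective p) λ ()
endsNE-lastNE (b ∷ [])      u           eq   (suc ()) _
endsNE-lastNE (D ∷ b′ ∷ bs) (_ ∷ u)     eq   (suc j) p =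
  endsNE-lastNE (b′ ∷ bs) u (List.∷-injectiveʳ eq) j (suc-injective p)
endsNE-lastNE (NE ∷ NE ∷ bs) []         eq   (suc j) p =
  contradiction (List.∷-injectiveʳ (List.∷-injectiveʳ eq)) λ ()
endsNE-lastNE (NE ∷ D ∷ bs) []          eq   (suc j) p =
  contradiction (List.∷-injectiveʳ (List.∷-injectiveʳ eq)) λ ()
endsNE-lastNE (NE ∷ b′ ∷ bs) (_ ∷ [])   eq   (suc j) p =
  contradiction (List.∷-injectiveˡ (List.∷-injectiveʳ eq)) λ ()
endsNE-lastNE (NE ∷ b′ ∷ bs) (_ ∷ _ ∷ u) eq  (suc j) p =
  endsNE-lastNE (b′ ∷ bs) u (List.∷-injectiveʳ (List.∷-injectiveʳ eq)) j (suc-injective p)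

filter-map-suc : ∀ {n} {P : Fin (suc n) → Set} {Q : Fin n → Set}
                 (P? : ∀ j → Dec (P j)) (Q? : ∀ j → Dec (Q j)) →
                 (∀ j → P (suc j) → Q j) → (∀ j → Q j → P (suc j)) →
                 ∀ js → length (filter P? (map suc js)) ≡ length (filter Q? js)
filter-map-suc P? Q? f g [] = refl
filter-map-suc P? Q? f g (j ∷ js) with P? (suc j) | Q? j
... | yes _ | yes _ = cong suc (filter-map-suc P? Q? f g js)
... | yes p | no ¬q = contradiction (f j p) ¬q
... | no ¬p | yes q = contradiction (g j q) ¬p
... | no _  | no _  = filter-map-suc P? Q? f g js

|blockDescents| : ∀ {n} (bs : Vec Block n) → 0 < n → LastNE bs →
                  #NE (toList bs) ≡ suc (length (blockDescents bs))
|blockDescents| {n} bs 0<n last =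
  trans (go bs 0<n last) (cong suc (sym (List.length-map _ (filter (P? bs) (allFin n)))))
  where
  P? : ∀ {n} (bs : Vec Block n) (j : Fin n) → Dec (suc (toℕ j) < n × Vec.lookup bs j ≡ NE)
  P? {n} bs j = suc (toℕ j) <? n ×-dec Vec.lookup bs j ≟ᵇ NE
  tail : ∀ {n} b (bs : Vec Block n) →
         length (filter (P? (b ∷ bs)) (List.tabulate suc)) ≡ length (filter (P? bs) (allFin n))
  tail {n} b bs = trans (cong (length ∘ filter (P? (b ∷ bs))) (sym (List.map-tabulate id suc)))
    (filter-map-suc (P? (b ∷ bs)) (P? bs)
      (λ { _ (s≤s lt , eq) → lt , eq }) (λ { _ (lt , eq) → s≤s lt , eq }) (allFin n))
  go : ∀ {n} (bs : Vec Block n) → 0 < n → LastNE bs →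
       #NE (toList bs) ≡ suc (length (filter (P? bs) (allFin n)))
  go (b ∷ []) _ last with refl ← last zero refl = refl
  go (NE ∷ bs@(_ ∷ _)) _ last =
    cong suc (trans (go bs (s≤s z≤n) (lastNE-tail {bs = bs} last)) (cong suc (sym (tail NE bs))))
  go (D ∷ bs@(_ ∷ _)) _ last =
    trans (go bs (s≤s z≤n) (lastNE-tail {bs = bs} last)) (cong suc (sym (tail D bs)))

blockDescents-unique : ∀ {n} (bs : Vec Block n) → Unique (blockDescents bs)
blockDescents-unique {n} bs = map-unique (Unique.filter⁺ P? (Unique.allFin⁺ n))
  where
  P? = λ j → suc (toℕ j) <? n ×-dec Vec.lookup bs j ≟ᵇ NE
  map-unique : ∀ {js : List (Fin n)} → Unique js → Unique (map (λ j → n ∸ suc (toℕ j)) js)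
  map-unique = Unique.map⁺ λ {i} {j} eq →
    Fin.toℕ-injective (suc-injective (∸-cancelˡ-≡ (Fin.toℕ<n i) (Fin.toℕ<n j) eq))

∈-blockDescents⁻ : ∀ {n} (bs : Vec Block n) {i} → i ∈ blockDescents bs →
                   ∃[ j ] i ≡ n ∸ suc (toℕ j) × suc (toℕ j) < n × Vec.lookup bs j ≡ NE
∈-blockDescents⁻ {n} bs i∈ with ∈-map⁻ _ i∈
... | j , j∈ , refl = j , refl , proj₂ (∈-filter⁻ (λ j → suc (toℕ j) <? n ×-dec Vec.lookup bs j ≟ᵇ NE) {xs = allFin n} j∈)

∈-blockDescents⁺ : ∀ {n} (bs : Vec Block n) j → suc (toℕ j) < n → Vec.lookup bs j ≡ NE →
                   n ∸ suc (toℕ j) ∈ blockDescents bs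
∈-blockDescents⁺ {n} bs j lt eq =
  ∈-map⁺ (λ j → n ∸ suc (toℕ j)) (∈-filter⁺ (λ j → suc (toℕ j) <? n ×-dec Vec.lookup bs j ≟ᵇ NE) (∈-allFin j) (lt , eq))

blockDescents-bounds : ∀ {n} (bs : Vec Block n) → All (λ i → 1 ≤ i × i < n) (blockDescents bs)
blockDescents-bounds {n} bs = All.tabulate λ i∈ → bound (∈-blockDescents⁻ bs i∈)
  where
  bound : ∀ {i} → ∃[ j ] i ≡ n ∸ suc (toℕ j) × suc (toℕ j) < n × Vec.lookup bs j ≡ NE → 1 ≤ i × i < n
  bound (j , refl , lt , _) = m<n⇒0<n∸m lt , ∸-monoʳ-< (s≤s z≤n) (<⇒≤ lt)

majBlocks-lastNE : ∀ n S → LastNE (majBlocks n S)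
majBlocks-lastNE n S j eq = trans (Vec.lookup∘tabulate _ j) (lem eq)
  where
  lem : suc (toℕ j) ≡ n →
        (if does (suc (toℕ j) ≟ n) then NE else
         if does (n ∸ suc (toℕ j) ∈? S) then NE else D) ≡ NE
  lem eq rewrite dec-true (suc (toℕ j) ≟ n) eq = refl

majBlocks-descents : ∀ n S → All (λ i → 1 ≤ i × i < n) S → blockDescents (majBlocks n S) ∼[ set ] S
majBlocks-descents n S bounds = mk⇔ to from
  where
  block : Fin n → Block
  block j = if does (suc (toℕ j) ≟ n) then NE else if does (n ∸ suc (toℕ j) ∈? S) then NE else D
  block⁻ : ∀ j → suc (toℕ j) < n → block j ≡ NE → n ∸ suc (toℕ j) ∈ S
  block⁻ j lt eq rewrite dec-false (suc (toℕ j) ≟ n) (<⇒≢ lt) = if-NE⁻ (n ∸ suc (toℕ j) ∈? S) eq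
    where
    if-NE⁻ : ∀ {P : Set} (P? : Dec P) → (if does P? then NE else D) ≡ NE → P
    if-NE⁻ (yes p) _  = p
    if-NE⁻ (no _)  ()
  block⁺ : ∀ j → suc (toℕ j) < n → n ∸ suc (toℕ j) ∈ S → block j ≡ NE
  block⁺ j lt i∈ rewrite dec-false (suc (toℕ j) ≟ n) (<⇒≢ lt)
                       | dec-true (n ∸ suc (toℕ j) ∈? S) i∈ = refl
  to : ∀ {i} → i ∈ blockDescents (majBlocks n S) → i ∈ S
  to i∈ with ∈-blockDescents⁻ (majBlocks n S) i∈
  ... | j , refl , lt , eq = block⁻ j lt (trans (sym (Vec.lookup∘tabulate block j)) eq)
  from : ∀ {i} → i ∈ S → i ∈ blockDescents (majBlocks n S)
  from {i} i∈ with All.lookup bounds i∈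
  from {suc i} i∈ | _ , lt = subst (_∈ blockDescents (majBlocks n S)) n∸1+j≡1+i
      (∈-blockDescents⁺ (majBlocks n S) j 1+j<n
        (trans (Vec.lookup∘tabulate block j) (block⁺ j 1+j<n (subst (_∈ S) (sym n∸1+j≡1+i) i∈))))
    where
    j<n : n ∸ suc (suc i) < n
    j<n = ∸-monoʳ-< (s≤s z≤n) lt
    j : Fin n
    j = Fin.fromℕ< j<n
    1+j≡n∸1+i : suc (toℕ j) ≡ n ∸ suc i
    1+j≡n∸1+i = trans (cong suc (Fin.toℕ-fromℕ< j<n)) (sym (+-∸-assoc 1 lt))
    1+j<n : suc (toℕ j) < n
    1+j<n = subst (_< n) (sym 1+j≡n∸1+i) (∸-monoʳ-< (s≤s z≤n) (<⇒≤ lt))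
    n∸1+j≡1+i : n ∸ suc (toℕ j) ≡ suc i
    n∸1+j≡1+i = trans (cong (n ∸_) 1+j≡n∸1+i) (m∸[m∸n]≡n (<⇒≤ lt))

unblock-isSch₀ : ∀ {n d} (bs : Vec Block n) → 0 < n → d ≤ n → LastNE bs → #NE (toList bs) ≡ n ∸ d →
                 IsSch₀ n d (unblock bs)
unblock-isSch₀ {n} {d} bs 0<n d≤n last #NE≡ = record
  { isSchröder = record
    { #N≡n∸d = trans (blocks-N (toList bs)) #NE≡
    ; #E≡n∸d = trans (blocks-E (toList bs)) #NE≡
    ; #D≡d   = trans (blocks-D (toList bs)) (+-cancelˡ-≡ (n ∸ d) _ _ (begin
        (n ∸ d) + #D (toList bs)          ≡⟨ cong (_+ #D (toList bs)) #NE≡ ⟨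
        #NE (toList bs) + #D (toList bs)  ≡⟨ #NE+#D (toList bs) ⟩
        length (toList bs)                ≡⟨ Vec.length-toList bs ⟩
        n                                 ≡⟨ m∸n+n≡m d≤n ⟨
        (n ∸ d) + d                       ∎))
    ; ballot = blocks-ballot (toList bs)
    }
  ; endsNE = lastNE-endsNE bs 0<n last
  ; area≡0 = blocks-area 0 (toList bs)
  }
  where open ≡-Reasoning

touch-unblocks : ∀ x w → areaFrom (x , x) w ≡ 0 → ∣ w ∣[ N ] ≡ ∣ w ∣[ E ] →
                 (∀ u v → w ≡ u ++ v → ∣ u ∣[ E ] ≤ ∣ u ∣[ N ]) → concatMap blockWord (touch w) ≡ w
touch-unblocks x []              a c b = refl
touch-unblocks x (E ∷ w)         a c b = contradiction (b (E ∷ []) w refl) λ ()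
touch-unblocks x (D ∷ w)         a c b = cong (D ∷_)
  (touch-unblocks (suc x) w (m+n≡0⇒n≡0 (x ∸ x) a) c λ u v eq → b (D ∷ u) v (cong (D ∷_) eq))
touch-unblocks x (N ∷ [])        a c b = contradiction c λ ()
touch-unblocks x (N ∷ E ∷ w)     a c b = cong (λ w → N ∷ E ∷ w)
  (touch-unblocks (suc x) w (m+n≡0⇒n≡0 (x ∸ x) a) (suc-injective c)
    λ u v eq → s≤s⁻¹ (b (N ∷ E ∷ u) v (cong (λ w → N ∷ E ∷ w) eq)))
touch-unblocks x (N ∷ N ∷ w)     a c b =
  contradiction (m+n≡0⇒m≡0 (suc x ∸ x) (m+n≡0⇒n≡0 (x ∸ x) a)) (m>n⇒m∸n≢0 (n<1+n x))
touch-unblocks x (N ∷ D ∷ w)     a c b =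
  contradiction (m+n≡0⇒m≡0 (suc x ∸ x) (m+n≡0⇒n≡0 (x ∸ x) a)) (m>n⇒m∸n≢0 (n<1+n x))

touch-correct : ∀ {n d w} → IsSch₀ n d w → concatMap blockWord (touch w) ≡ w
touch-correct {w = w} w∈ =
  touch-unblocks 0 w area≡0 (trans #N≡n∸d (sym #E≡n∸d)) ballot
  where open IsSch₀ w∈; open IsSchröder isSchröder

#NE-touch : ∀ {n d w} → IsSch₀ n d w → #NE (touch w) ≡ n ∸ d
#NE-touch {w = w} w∈ = trans (sym (blocks-N (touch w)))
  (trans (cong ∣_∣[ N ] (touch-correct w∈)) #N≡n∸d)
  where open IsSch₀ w∈; open IsSchröder isSchröder

|touch| : ∀ {n d w} → d ≤ n → IsSch₀ n d w → length (touch w) ≡ n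
|touch| {n} {d} {w} d≤n w∈ = begin
  length (touch w)               ≡⟨ #NE+#D (touch w) ⟨
  #NE (touch w) + #D (touch w)   ≡⟨ cong₂ _+_ (#NE-touch w∈) (sym (blocks-D (touch w))) ⟩
  (n ∸ d) + ∣ concatMap blockWord (touch w) ∣[ D ]
                                 ≡⟨ cong (λ w → (n ∸ d) + ∣ w ∣[ D ]) (touch-correct w∈) ⟩
  (n ∸ d) + ∣ w ∣[ D ]           ≡⟨ cong ((n ∸ d) +_) #D≡d ⟩
  (n ∸ d) + d                    ≡⟨ m∸n+n≡m d≤n ⟩
  n                              ∎
  where open ≡-Reasoning; open IsSch₀ w∈; open IsSchröder isSchröder

Touch : ∀ {n d} → .(d ≤ n) → Sch₀ n d → Vec Block n
Touch d≤n (mkSch₀ w w∈) = Vec.cast (|touch| d≤n w∈) (fromList (touch w))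

toList-Touch : ∀ {n d} .(d≤n : d ≤ n) (γ : Sch₀ n d) → toList (Touch d≤n γ) ≡ touch (Sch₀.word γ)
toList-Touch d≤n (mkSch₀ w w∈) =
  trans (Vec.toList-cast (|touch| d≤n w∈) (fromList (touch w))) (Vec.toList∘fromList (touch w))

unblock-Touch : ∀ {n d} .(d≤n : d ≤ n) (γ : Sch₀ n d) → unblock (Touch d≤n γ) ≡ Sch₀.word γ
unblock-Touch d≤n γ@(mkSch₀ w w∈) =
  trans (cong (concatMap blockWord) (toList-Touch d≤n γ))
        (recompute (List.≡-dec _≟ˢ_ _ _) (touch-correct w∈))

∸-pred : ∀ {n d} → 1 ≤ d → d ≤ n → n ∸ (d ∸ 1) ≡ suc (n ∸ d)
∸-pred {suc n} {suc d} _ (s≤s d≤n) = +-∸-assoc 1 d≤n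

Des-bounds : ∀ n d → 1 ≤ d → d ≤ n → ∀ rows (p : IsSYT (hook n d) rows) →
             All (λ i → 1 ≤ i × i < n) (Des (mkSYT rows p))
Des-bounds n (suc a) _ d≤n rows p with hookParts a (n ∸ suc a) rows p
... | xs , cs , refl , parts = All.tabulate λ i∈ →
  proj₁ (∈[1⋯]⁻ (proj₁ (∈-filter⁻ (descent? rows) {xs = [1⋯ sum (hook n (suc a)) ]} i∈))) ,
  subst (_ <_) sum-hook (proj₂ (∈[1⋯]⁻ (∈-resp-↭ (HookParts.perm parts) (there (∈-++⁺ʳ xs (∈-Des⁻ parts i∈))))))
  where
  sum-hook : sum (hook n (suc a)) ≡ n
  sum-hook = trans (cong (suc a +_) (sum-ones (n ∸ suc a))) (m+[n∸m]≡n d≤n)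

ℳ-isSch₀ : ∀ n d → 1 ≤ d → d ≤ n → ∀ rows (p : IsSYT (hook n d) rows) →
           IsSch₀ n (d ∸ 1) (unblock (majBlocks n (Des (mkSYT rows p))))
ℳ-isSch₀ n d 1≤d d≤n rows p = unblock-isSch₀ bs 0<n (≤-trans (m∸n≤m d 1) d≤n) last (begin
  #NE (toList bs)                 ≡⟨ |blockDescents| bs 0<n last ⟩
  suc (length (blockDescents bs)) ≡⟨ cong suc (set⇒length (blockDescents-unique bs)
                                       (Unique.filter⁺ (descent? rows) (sorted⇒unique ([1⋯]↗ (sum (hook n d)))))
                                       (majBlocks-descents n S (Des-bounds n d 1≤d d≤n rows p))) ⟩
  suc (length S)                  ≡⟨ cong suc (|Des|-hook n d 1≤d rows p) ⟩
  suc (n ∸ d)                     ≡⟨ ∸-pred 1≤d d≤n ⟨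
  n ∸ (d ∸ 1)                     ∎)
  where
  open ≡-Reasoning
  S = Des (mkSYT rows p)
  bs = majBlocks n S
  0<n = ≤-trans 1≤d d≤n
  last = majBlocks-lastNE n S

|blockDescents-Touch| : ∀ n d → (1≤d : 1 ≤ d) (d≤n : d ≤ n) → ∀ w (w∈ : IsSch₀ n (d ∸ 1) w) →
  length (blockDescents (Touch (≤-trans (m∸n≤m d 1) d≤n) (mkSch₀ w w∈))) ≡ n ∸ d
|blockDescents-Touch| n d 1≤d d≤n w w∈ = suc-injective (begin
  suc (length (blockDescents bs)) ≡⟨ |blockDescents| bs (≤-trans 1≤d d≤n) last ⟨
  #NE (toList bs)                 ≡⟨ cong #NE (toList-Touch d-1≤n γ) ⟩
  #NE (touch w)                   ≡⟨ #NE-touch w∈ ⟩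
  n ∸ (d ∸ 1)                     ≡⟨ ∸-pred 1≤d d≤n ⟩
  suc (n ∸ d)                     ∎)
  where
  open ≡-Reasoning
  d-1≤n = ≤-trans (m∸n≤m d 1) d≤n
  γ = mkSch₀ w w∈
  bs = Touch d-1≤n γ
  last : LastNE bs
  last = let u , eq = IsSch₀.endsNE w∈ in endsNE-lastNE bs u (trans (unblock-Touch d-1≤n γ) eq)

ℳ : ∀ n d → .(1 ≤ d) → .(d ≤ n) → SYT (hook n d) → Sch₀ n (d ∸ 1)
ℳ n d 1≤d d≤n τ@(mkSYT rows p) = mkSch₀ (unblock (majBlocks n (Des τ))) (ℳ-isSch₀ n d 1≤d d≤n rows p)

ℛ-∃! : ∀ n d → .(1 ≤ d) → .(d≤n : d ≤ n) → (γ : Sch₀ n (d ∸ 1)) →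
       ∃! _≡_ λ (τ : SYT (hook n d)) → Des τ ∼[ set ] blockDescents (Touch (≤-trans (m∸n≤m d 1) d≤n) γ)
ℛ-∃! n d 1≤d d≤n γ@(mkSch₀ w w∈) = hook-∃! n d 1≤d d≤n (blockDescents bs)
  (blockDescents-unique bs) (blockDescents-bounds bs) (|blockDescents-Touch| n d 1≤d d≤n w w∈)
  where bs = Touch (≤-trans (m∸n≤m d 1) d≤n) γ

ℛ : ∀ n d → .(1 ≤ d) → .(d ≤ n) → Sch₀ n (d ∸ 1) → SYT (hook n d)
ℛ n d 1≤d d≤n γ = proj₁ (ℛ-∃! n d 1≤d d≤n γ)

{-# OPTIONS --safe #-}

-- Both statistics count pairs of positions i < j with γᵢ = NE: a descent n − i
-- is the number of blocks after γᵢ. Since Γ(γ) is the staircase (NE)ᵏ, which is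
-- its own bounce path, bounce(Γ(γ)) counts the pairs with γⱼ = NE and numph(γ)
-- counts those with γⱼ = D.
module Submission where

open import Defs
open import Data.Bool using (if_then_else_)
open import Data.Fin using (Fin; zero; suc; toℕ)
import Data.Fin.Properties as Fin
open import Data.List using (List; []; _∷_; length; map; filter; concatMap; replicate; allFin)
import Data.List as List
import Data.List.Properties as List
open import Data.List.Membership.Propositional using (_∈_)
open import Data.List.Membership.Propositional.Properties.WithK using (unique∧set⇒bag)
open import Data.List.Relation.Binary.BagAndSetEquality using (_∼[_]_; set; ∼bag⇒↭)
open import Data.List.Relation.Unary.All as All using (All; []; _∷_)
open import Data.List.Relation.Unary.Any using (here; there)
import Data.List.Relation.Unary.Unique.Propositional.Properties as Unique
open import Data.Nat
open import Data.Nat.ListAction using (sum)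
open import Data.Nat.ListAction.Properties using (sum-↭)
open import Data.Nat.Properties
open import Data.Nat.Tactic.RingSolver using (solve-∀)
open import Data.Product using (_×_; _,_; proj₁; proj₂)
open import Data.Vec as Vec using (Vec; []; _∷_; toList)
import Data.Vec.Properties as Vec
open import Function using (_∘_; _⇔_; mk⇔; Equivalence)
open import Function.Definitions using (Bijective; Inverseᵇ)
open import Function.Properties.Equivalence using () renaming (sym to ⇔-sym)
open import Relation.Binary.PropositionalEquality
  using (_≡_; refl; sym; trans; cong; cong₂; subst; module ≡-Reasoning)
open import Relation.Nullary using (Dec; yes; no; does; ¬_; contradiction; recompute)
open import Relation.Nullary.Decidable using (_×-dec_; dec-true; dec-false)

import Data.List.Membership.DecPropositional as DecMembership
open DecMembership _≟_ using (_∈?_)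
open DecMembership _≟ᵖ_ using () renaming (_∈?_ to _∈ᵖ?_)

-- Pairs of blocks and the major index.

-- The number of pairs i < j with γᵢ = `NE`, grouped by their first position.
weight : List Block → ℕ
weight []        = 0
weight (NE ∷ bs) = length bs + weight bs
weight (D ∷ bs)  = weight bs

map-filter-suc : ∀ {A : Set} {n} {P : Fin (suc n) → Set} {Q : Fin n → Set}
                 (P? : ∀ j → Dec (P j)) (Q? : ∀ j → Dec (Q j)) {g : Fin (suc n) → A} {h : Fin n → A} →
                 (∀ j → P (suc j) ⇔ Q j) → (∀ j → g (suc j) ≡ h j) →
                 ∀ js → map g (filter P? (map suc js)) ≡ map h (filter Q? js)
map-filter-suc P? Q? P⇔Q g≡h [] = refl
map-filter-suc P? Q? P⇔Q g≡h (j ∷ js) with P? (suc j) | Q? j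
... | yes _ | yes _ = cong₂ _∷_ (g≡h j) (map-filter-suc P? Q? P⇔Q g≡h js)
... | yes p | no ¬q = contradiction (Equivalence.to (P⇔Q j) p) ¬q
... | no ¬p | yes q = contradiction (Equivalence.from (P⇔Q j) q) ¬p
... | no _  | no _  = map-filter-suc P? Q? P⇔Q g≡h js

-- A position contributes the number of blocks after it; for the last block, which `blockDescents`
-- leaves out, this is 0.
sum-blockDescents : ∀ {n} (bs : Vec Block n) → sum (blockDescents bs) ≡ weight (toList bs)
sum-blockDescents []        = refl
sum-blockDescents (NE ∷ []) = refl
sum-blockDescents (D ∷ [])  = refl
-- As a second block exists, the head passes the bound 1 < `suc n` by computation, and only `b`
-- decides whether it is kept.
sum-blockDescents {suc n} (b ∷ bs@(_ ∷ _)) = step b (sum-blockDescents bs)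
  where
  P? : ∀ {n} (bs : Vec Block n) (j : Fin n) → Dec (suc (toℕ j) < n × Vec.lookup bs j ≡ NE)
  P? {n} bs j = suc (toℕ j) <? n ×-dec Vec.lookup bs j ≟ᵇ NE
  tail : ∀ b → map (λ j → suc n ∸ suc (toℕ j)) (filter (P? (b ∷ bs)) (List.tabulate suc)) ≡ blockDescents bs
  tail b = trans
    (cong (map (λ j → suc n ∸ suc (toℕ j)) ∘ filter (P? (b ∷ bs))) (sym (List.map-tabulate (λ j → j) suc)))
    (map-filter-suc (P? (b ∷ bs)) (P? bs)
      (λ _ → mk⇔ (λ { (s≤s lt , eq) → lt , eq }) (λ { (lt , eq) → s≤s lt , eq })) (λ _ → refl) (allFin n))
  step : ∀ b → sum (blockDescents bs) ≡ weight (toList bs) → sum (blockDescents (b ∷ bs)) ≡ weight (b ∷ toList bs)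
  step NE ih = cong₂ _+_ (sym (Vec.length-toList bs)) (trans (cong sum (tail NE)) ih)
  step D  ih = trans (cong sum (tail D)) ih

-- The bounce statistic of a word of blocks.

staircase : ℕ → Word
staircase k = concatMap blockWord (replicate k NE)

Γ-blocks : ∀ bs → Γ (concatMap blockWord bs) ≡ staircase (#NE bs)
Γ-blocks []        = refl
Γ-blocks (NE ∷ bs) = cong (λ w → N ∷ E ∷ w) (Γ-blocks bs)
Γ-blocks (D ∷ bs)  = Γ-blocks bs

staircase-N : ∀ k → ∣ staircase k ∣[ N ] ≡ k
staircase-N zero    = refl
staircase-N (suc k) = cong suc (staircase-N k)

staircaseEasts : ℕ → ℕ → List Point
staircaseEasts x r = eastStarts (x , x) (staircase r)

∈-staircaseEasts : ∀ {x i} r → x ≤ i → i < x + r → (i , suc i) ∈ staircaseEasts x r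
∈-staircaseEasts {x} {i} zero x≤i i<x+r = contradiction x≤i (<⇒≱ (subst (i <_) (+-identityʳ x) i<x+r))
∈-staircaseEasts {x} {i} (suc r) x≤i i<x+r with x ≟ i
... | yes refl = here refl
... | no x≢i   = there (∈-staircaseEasts r (≤∧≢⇒< x≤i x≢i) (subst (i <_) (+-suc x r) i<x+r))

staircaseEasts-offDiagonal : ∀ x r → All (λ p → ¬ (proj₁ p ≡ proj₂ p)) (staircaseEasts x r)
staircaseEasts-offDiagonal x zero    = []
staircaseEasts-offDiagonal x (suc r) = (1+n≢n ∘ sym) ∷ staircaseEasts-offDiagonal (suc x) r

-- Every `E` follows an `N`, so every east step will be a peak step.
turns-staircase : ∀ x r → turnsFrom (x , x) (staircase r) ≡ staircaseEasts x r
turns-staircase x zero    = refl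
turns-staircase x (suc r) = cong ((x , suc x) ∷_) (turns-staircase (suc x) r)

-- From a diagonal point the path goes north once, meets an east step there and returns to the
-- diagonal, still heading east. The list `es` stays fixed along the recursion, so it need only
-- contain the starting points still ahead.
east-staircase : ∀ es x r → (∀ {i} → x ≤ i → i < x + r → (i , suc i) ∈ es) →
                 east es (length (staircase r)) (x , x) ≡ staircase r
east-staircase es x zero    ∈es = refl
east-staircase es x (suc r) ∈es
  rewrite dec-true (x ≟ x) refl
        | dec-true ((x , suc x) ∈ᵖ? es) (∈es ≤-refl (m<m+n x (s≤s z≤n))) =
  cong (λ w → N ∷ E ∷ w) (east-staircase es (suc x) r
    (λ {i} x<i i<x+r → ∈es (<⇒≤ x<i) (subst (i <_) (sym (+-suc x r)) i<x+r)))

-- At the origin the bounce path heads north, not east; both headings agree on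
-- the diagonal, where no east step starts.
bouncePath-staircase : ∀ k → bouncePath (staircase k) ≡ staircase k
bouncePath-staircase zero    = refl
bouncePath-staircase k@(suc r)
  rewrite dec-false ((0 , 0) ∈ᵖ? staircaseEasts 0 k)
            (λ 0∈ → All.lookup (staircaseEasts-offDiagonal 0 k) 0∈ refl) =
  east-staircase (staircaseEasts 0 k) 0 k (∈-staircaseEasts k)

-- The binomial coefficient "r choose 2": the pairs of `NE` blocks.
triangle : ℕ → ℕ
triangle zero    = 0
triangle (suc r) = r + triangle r

-- The size `x + r` of the whole staircase is invariant under the recursion, and the next return, at
-- `suc x`, leaves one step fewer than `r`.
sum-returns-staircase : ∀ x r → sum (map (x + r ∸_) (returnsFrom (x , x) (staircase r))) ≡ triangle r
sum-returns-staircase x zero = refl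
sum-returns-staircase x (suc r)
  rewrite dec-false (x ≟ suc x) (1+n≢n ∘ sym) | dec-true (x ≟ x) refl | +-suc x r =
  cong₂ _+_ (m+n∸m≡n x r) (sum-returns-staircase (suc x) r)

bounceDyck-staircase : ∀ k → bounceDyck (staircase k) ≡ triangle k
bounceDyck-staircase k rewrite bouncePath-staircase k | staircase-N k = sum-returns-staircase 0 k

-- The product `c * #D bs` pairs the `c` peak steps already met with the diagonal steps ahead. Of
-- the pairs inside `bs`, those ending in `D` come from `numphFrom`, those ending in `NE` from
-- `triangle`.
numph-blocks : ∀ ts x c bs → (∀ {i} → x ≤ i → i < x + #NE bs → (i , suc i) ∈ ts) →
               numphFrom ts (x , x) c (concatMap blockWord bs) + triangle (#NE bs) ≡ c * #D bs + weight bs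
numph-blocks ts x c []        ∈ts = sym (trans (+-identityʳ _) (*-zeroʳ c))
numph-blocks ts x c (D ∷ bs)  ∈ts = begin
  c + u + t                       ≡⟨ +-assoc c u t ⟩
  c + (u + t)                     ≡⟨ cong (c +_) (numph-blocks ts x c bs ∈ts) ⟩
  c + (c * #D bs + weight bs)     ≡⟨ +-assoc c (c * #D bs) (weight bs) ⟨
  c + c * #D bs + weight bs       ≡⟨ cong (_+ weight bs) (*-suc c (#D bs)) ⟨
  c * suc (#D bs) + weight bs     ∎
  where
  open ≡-Reasoning
  u = numphFrom ts (x , x) c (concatMap blockWord bs)
  t = triangle (#NE bs)
numph-blocks ts x c (NE ∷ bs) ∈ts
  rewrite dec-true ((x , suc x) ∈ᵖ? ts) (∈ts ≤-refl (m<m+n x (s≤s z≤n))) = begin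
  u + (k + t)                             ≡⟨ left u k t ⟩
  k + (u + t)                             ≡⟨ cong (k +_) (numph-blocks ts (suc x) (suc c) bs ∈ts′) ⟩
  k + (suc c * #D bs + weight bs)         ≡⟨ right k (#D bs) c (weight bs) ⟩
  -- The new peak step is paired with all later blocks, of either kind.
  c * #D bs + (k + #D bs + weight bs)     ≡⟨ cong (λ l → c * #D bs + (l + weight bs)) (#NE+#D bs) ⟩
  c * #D bs + (length bs + weight bs)     ∎
  where
  open ≡-Reasoning
  k = #NE bs
  u = numphFrom ts (suc x , suc x) (suc c) (concatMap blockWord bs)
  t = triangle k
  ∈ts′ : ∀ {i} → suc x ≤ i → i < suc x + k → (i , suc i) ∈ ts
  ∈ts′ {i} x<i i<x+k = ∈ts (<⇒≤ x<i) (subst (i <_) (sym (+-suc x k)) i<x+k)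
  left : ∀ u k t → u + (k + t) ≡ k + (u + t)
  left = solve-∀
  right : ∀ k d c w → k + (suc c * d + w) ≡ c * d + (k + d + w)
  right = solve-∀

-- At the start no peak step has been met, so the term with `c` vanishes and only the pairs inside
-- `bs` remain.
bounce-blocks : ∀ bs → let w = concatMap blockWord bs in bounceDyck (Γ w) + numph w ≡ weight bs
bounce-blocks bs
  rewrite Γ-blocks bs | bounceDyck-staircase (#NE bs) | bouncePath-staircase (#NE bs)
        | turns-staircase 0 (#NE bs) =
  trans (+-comm (triangle (#NE bs)) _)
        (numph-blocks (staircaseEasts 0 (#NE bs)) 0 0 bs (∈-staircaseEasts (#NE bs)))

-- The inverse maps and the comparison of the statistics.

touch-blocks : ∀ bs → touch (concatMap blockWord bs) ≡ bs
touch-blocks []        = refl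
touch-blocks (NE ∷ bs) = cong (NE ∷_) (touch-blocks bs)
touch-blocks (D ∷ bs)  = cong (D ∷_) (touch-blocks bs)

Touch-unblock : ∀ {n d} .(d≤n : d ≤ n) (bs : Vec Block n) .(w∈ : IsSch₀ n d (unblock bs)) →
                Touch d≤n (mkSch₀ (unblock bs) w∈) ≡ bs
-- `Vec.toList-injective` gives equality only up to a cast, here along `refl`.
Touch-unblock d≤n bs w∈ = trans (sym (Vec.cast-is-id refl _))
  (Vec.toList-injective refl _ bs (trans (toList-Touch d≤n (mkSch₀ (unblock bs) w∈)) (touch-blocks (toList bs))))

-- `S` determines every block but the last, and `LastNE` supplies that one.
majBlocks-≡ : ∀ {n S} (bs : Vec Block n) → LastNE bs → S ∼[ set ] blockDescents bs → majBlocks n S ≡ bs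
majBlocks-≡ {n} {S} bs last S∼ = trans (Vec.tabulate-cong pointwise) (Vec.tabulate∘lookup bs)
  where
  if-≡ : ∀ {P Q : Set} (P? : Dec P) (Q? : Dec Q) {b} → (P → b ≡ NE) → (Q → b ≡ NE) →
         (¬ P → b ≡ NE → Q) → (if does P? then NE else if does Q? then NE else D) ≡ b
  if-≡ (yes p) _       f g h = sym (f p)
  if-≡ (no _)  (yes q) f g h = sym (g q)
  if-≡ (no ¬p) (no ¬q) {NE} f g h = contradiction (h ¬p refl) ¬q
  if-≡ (no ¬p) (no ¬q) {D}  f g h = refl
  NE⁺ : ∀ j → n ∸ suc (toℕ j) ∈ S → Vec.lookup bs j ≡ NE
  NE⁺ j i∈ with ∈-blockDescents⁻ bs (Equivalence.to S∼ i∈)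
  -- The number of blocks after a position determines the position, so `j′` is `j`.
  ... | j′ , eq , _ , NE-j′ = subst (λ j → Vec.lookup bs j ≡ NE)
    (Fin.toℕ-injective (suc-injective (∸-cancelˡ-≡ (Fin.toℕ<n j′) (Fin.toℕ<n j) (sym eq)))) NE-j′
  pointwise : ∀ j → (if does (suc (toℕ j) ≟ n) then NE else
                     if does (n ∸ suc (toℕ j) ∈? S) then NE else D) ≡ Vec.lookup bs j
  pointwise j = if-≡ (suc (toℕ j) ≟ n) (n ∸ suc (toℕ j) ∈? S) (last j) (NE⁺ j)
    λ j≢ NE-j → Equivalence.from S∼ (∈-blockDescents⁺ bs j (≤∧≢⇒< (Fin.toℕ<n j) j≢) NE-j)

Sch₀-≡ : ∀ {n d} {γ γ′ : Sch₀ n d} → Sch₀.word γ ≡ Sch₀.word γ′ → γ ≡ γ′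
Sch₀-≡ refl = refl

SYT-≡ : ∀ {sh} {τ τ′ : SYT sh} → SYT.rows τ ≡ SYT.rows τ′ → τ ≡ τ′
SYT-≡ refl = refl

module _ (n d : ℕ) (1≤d : 1 ≤ d) (d≤n : d ≤ n) where
  private
    d-1≤n : d ∸ 1 ≤ n
    d-1≤n = ≤-trans (m∸n≤m d 1) d≤n

  ℳ-ℛ : ∀ γ → ℳ n d 1≤d d≤n (ℛ n d 1≤d d≤n γ) ≡ γ
  -- Equality of words is decidable, so it may be derived from the irrelevant `w∈`.
  ℳ-ℛ γ@(mkSch₀ w w∈) = Sch₀-≡ (recompute (List.≡-dec _≟ˢ_ _ _) (word-≡ w∈))
    where
    bs = Touch d-1≤n γ
    word-≡ : IsSch₀ n (d ∸ 1) w → unblock (majBlocks n (Des (ℛ n d 1≤d d≤n γ))) ≡ w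
    word-≡ w∈ = trans
      (cong unblock (majBlocks-≡ bs
        (let u , eq = IsSch₀.endsNE w∈ in endsNE-lastNE bs u (trans (unblock-Touch d-1≤n γ) eq))
        (proj₁ (proj₂ (ℛ-∃! n d 1≤d d≤n γ)))))
      (unblock-Touch d-1≤n γ)

  Des-∼-blockDescents : ∀ rows (p : IsSYT (hook n d) rows) → let S = Des (mkSYT rows p) in
                        S ∼[ set ] blockDescents (majBlocks n S)
  Des-∼-blockDescents rows p =
    ⇔-sym (majBlocks-descents n (Des (mkSYT rows p)) (Des-bounds n d 1≤d d≤n rows p))

  -- By uniqueness in `ℛ-∃!`: `τ` itself has the descent set prescribed by its image.
  ℛ-ℳ : ∀ τ → ℛ n d 1≤d d≤n (ℳ n d 1≤d d≤n τ) ≡ τ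
  ℛ-ℳ τ@(mkSYT rows p) = SYT-≡ (recompute (List.≡-dec (List.≡-dec _≟_) _ _) (rows-≡ p))
    where
    rows-≡ : (p : IsSYT (hook n d) rows) → SYT.rows (ℛ n d 1≤d d≤n (ℳ n d 1≤d d≤n τ)) ≡ rows
    rows-≡ p = cong SYT.rows {y = τ} (proj₂ (proj₂ (ℛ-∃! n d 1≤d d≤n (ℳ n d 1≤d d≤n τ)))
      (λ {i} → subst (λ bs → i ∈ Des τ ⇔ i ∈ blockDescents bs)
        (sym (Touch-unblock d-1≤n (majBlocks n (Des τ)) (ℳ-isSch₀ n d 1≤d d≤n rows p)))
        (Des-∼-blockDescents rows p)))

  maj-bounce-ℳ : ∀ τ → maj τ ≡ bounce (ℳ n d 1≤d d≤n τ)
  maj-bounce-ℳ τ@(mkSYT rows p) = recompute (_ ≟ _) (maj≡bounce p)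
    where
    open ≡-Reasoning
    bs = majBlocks n (Des τ)
    maj≡bounce : IsSYT (hook n d) rows → maj τ ≡ bounce (ℳ n d 1≤d d≤n τ)
    maj≡bounce p = begin
      -- The lists run in opposite orders; being free of repetitions with the same elements, they
      -- are permutations of each other.
      sum (Des τ)                 ≡⟨ sum-↭ (∼bag⇒↭ (unique∧set⇒bag
                                       (Unique.filter⁺ (descent? rows) (sorted⇒unique ([1⋯]↗ (sum (hook n d)))))
                                       (blockDescents-unique bs) (Des-∼-blockDescents rows p))) ⟩
      sum (blockDescents bs)      ≡⟨ sum-blockDescents bs ⟩
      weight (toList bs)          ≡⟨ bounce-blocks (toList bs) ⟨
      bounce (ℳ n d 1≤d d≤n τ)    ∎

proposition7 : ∀ (n d : ℕ) (1≤d : 1 ≤ d) (d≤n : d ≤ n) →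
    Bijective _≡_ _≡_ (ℳ n d 1≤d d≤n)
    × Inverseᵇ _≡_ _≡_ (ℳ n d 1≤d d≤n) (ℛ n d 1≤d d≤n)
    × (∀ τ → maj τ ≡ bounce (ℳ n d 1≤d d≤n τ))
    × (∀ γ → maj (ℛ n d 1≤d d≤n γ) ≡ bounce γ)
proposition7 n d 1≤d d≤n =
  ( (λ {τ} {τ′} eq → trans (sym (ℛ-ℳ n d 1≤d d≤n τ)) (trans (cong (ℛ n d 1≤d d≤n) eq) (ℛ-ℳ n d 1≤d d≤n τ′)))
  , (λ γ → ℛ n d 1≤d d≤n γ , λ { refl → ℳ-ℛ n d 1≤d d≤n γ })) ,
  ((λ { {γ} refl → ℳ-ℛ n d 1≤d d≤n γ }) , (λ { {τ} refl → ℛ-ℳ n d 1≤d d≤n τ })) ,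
  maj-bounce-ℳ n d 1≤d d≤n ,
  -- The preceding claim, applied to the preimage of `γ`.
  (λ γ → trans (maj-bounce-ℳ n d 1≤d d≤n (ℛ n d 1≤d d≤n γ)) (cong bounce (ℳ-ℛ n d 1≤d d≤n γ)))
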